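{- Let $t$ be a positive integer. There exist a positive integer $m=m(t)$ (depending only on $t$) and numbers $\varphi(n,t)$ with $\varphi(n,t)=\mathcal{O}(n^{2-\frac1m})$ as $n\to\infty$ such that, for all sufficiently large $n$, every $2$-coloring $E(K_n)=E(R)\cup E(B)$ with $\min\{e(R),e(B)\}\ge \varphi(n,t)$ contains a type-$A$ or a type-$B$ colored copy of $K_{2t}$.
   Context: A $2$-coloring $E(K_n)=E(R)\cup E(B)$ is a partition of the edge set of the complete graph $K_n$ into red edges (forming the graph $R$) and blue edges (forming the graph $B$); $e(R)$ and $e(B)$ denote the numbers of red and blue edges. A $2$-edge-colored complete graph $K_{2t}$ is of type $A$ if the edges of one of the two colors (either red or blue) form a complete graph $K_t$, i.e. there is a set $S$ of $t$ of its vertices such that the edges with both ends in $S$ are exactly the edges of one color. It is of type $B$ if the edges of one of the two colors (either red or blue) form a complete bipartite graph $K_{t,t}$, i.e. there is a partition of its vertices into two sets of size $t$ such that the edges between the two sets are exactly the edges of one color. -}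

module Defs where

open import Data.Fin using (Fin; _<?_)
open import Data.Fin.Subset using (_∈_; _∉_; ∣_∣)
open import Data.List using (List; allFin; cartesianProduct; filter; length)
open import Data.Nat using (ℕ; _*_; _∸_; _^_; _≤_)
open import Data.Product using (∃-syntax; _×_; proj₁; proj₂)
open import Data.Sum using (_⊎_)
open import Function using (_⇔_; _↣_; Injection)
open import Relation.Binary using (DecidableEquality)
open import Relation.Binary.PropositionalEquality using (_≡_; _≢_; refl)
open import Relation.Nullary using (yes; no)

data Colour : Set where
  red blue : Colour

_≟ᶜ_ : DecidableEquality Colour
red  ≟ᶜ red  = yes refl
red  ≟ᶜ blue = no λ ()
blue ≟ᶜ red  = no λ ()
blue ≟ᶜ blue = yes refl

-- The edges of K_n are the unordered pairs of distinct vertices.  The value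
-- of a colouring on the diagonal has no meaning and is never consulted.
record Colouring (n : ℕ) : Set where
  field
    colour    : Fin n → Fin n → Colour
    symmetric : ∀ i j → colour i j ≡ colour j i

open Colouring public

-- Each edge {i , j} is listed once, as the pair with i < j.
edges : ∀ n → List (Fin n × Fin n)
edges n = filter (λ e → proj₁ e <? proj₂ e) (cartesianProduct (allFin n) (allFin n))

-- e red χ and e blue χ are e(R) and e(B).
e : ∀ {n} → Colour → Colouring n → ℕ
e {n} c χ = length (filter (λ ij → colour χ (proj₁ ij) (proj₂ ij) ≟ᶜ c) (edges n))

TypeA : ∀ t → Colouring (2 * t) → Set
TypeA t χ = ∃[ c ] ∃[ S ] ∣ S ∣ ≡ t ×
  (∀ i j → i ≢ j → (colour χ i j ≡ c ⇔ (i ∈ S × j ∈ S)))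

-- The two parts are S and its complement; as there are 2t vertices, the
-- complement has size t as soon as S does.
TypeB : ∀ t → Colouring (2 * t) → Set
TypeB t χ = ∃[ c ] ∃[ S ] ∣ S ∣ ≡ t ×
  (∀ i j → i ≢ j → (colour χ i j ≡ c ⇔ ((i ∈ S × j ∉ S) ⊎ (i ∉ S × j ∈ S))))

restrict : ∀ {k n} → Fin k ↣ Fin n → Colouring n → Colouring k
restrict f χ = record
  { colour    = λ i j → colour χ (to i) (to j)
  ; symmetric = λ i j → symmetric χ (to i) (to j)
  }
  where open Injection f using (to)

ContainsCopy : ∀ {k n} → (Colouring k → Set) → Colouring n → Set
ContainsCopy {k} {n} P χ = ∃[ f ] P (restrict {k} {n} f χ)

-- φ(n) = O(n^(2 - 1/m)) for m ≥ 1: the bound φ(n) ≤ C n^(2 - 1/m) for all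
-- n ≥ N, with both sides raised to the power m to avoid the fractional
-- exponent.  Natural C loses no generality, since C may be enlarged; nor does
-- natural φ as a threshold for edge counts, since a real one may be replaced by
-- its ceiling (2 - 1/m ≥ 1, so the order of growth is unchanged).
IsO[n^2-1/_] : ℕ → (ℕ → ℕ) → Set
IsO[n^2-1/ m ] φ = ∃[ C ] ∃[ N ] ∀ n → N ≤ n → φ n ^ m ≤ C ^ m * n ^ (2 * m ∸ 1)

{-# OPTIONS --safe #-}

-- By Kővári–Sós–Turán each colour class contains a large complete bipartite
-- graph, and by Ramsey's theorem both of its sides may be taken monochromatic.
-- If both sides have the other colour, this is a type-B copy; otherwise one
-- side is a large clique in the given colour.  If that happens for both
-- colours, a bipartite Ramsey argument between the red and the blue clique
-- gives a red K_t and a blue K_t joined in one colour, which is a type-A copy.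
module Submission where

open import Data.Fin using (Fin; zero; suc; splitAt; join; _<?_)
open import Data.Fin.Properties using (_≟_; <⇒≢; join-splitAt)
open import Data.Fin.Subset using (Subset; _∈_; _∉_; ∣_∣; ⊤; ⊥)
open import Data.Fin.Subset.Properties using (∉⊥; ∣⊥∣≡0; drop-there)
open import Data.List using (List; []; _∷_; _++_; length; map; filter; take; lookup; allFin; cartesianProduct)
open import Data.List.Properties using (length-++; length-take; length-tabulate; filter-++)
open import Data.List.Relation.Binary.Sublist.Propositional using (_⊆_; []; _∷_; _∷ʳ_; ⊆-refl; ⊆-trans; minimum)
open import Data.List.Membership.Propositional.Properties using (∈-lookup)
open import Data.List.Relation.Binary.Sublist.Propositional.Properties using (All-resp-⊆; filter-⊆)
open import Data.List.Relation.Unary.All as All using (All; []; _∷_)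
open import Data.List.Relation.Unary.All.Properties as Allₚ using (all-filter; All-swap)
open import Data.List.Relation.Unary.AllPairs as AllPairs using (AllPairs; []; _∷_)
import Data.List.Relation.Unary.AllPairs.Properties as AllPairsₚ
open import Data.List.Relation.Unary.Unique.Propositional using (Unique)
open import Data.List.Relation.Unary.Unique.Propositional.Properties using (allFin⁺)
open import Data.Nat using (ℕ; zero; suc; _+_; _*_; _^_; _≤_; _<_; _⊓_; _∸_; pred; _≤?_; z≤n; s≤s; NonZero; >-nonZero)
open import Data.Nat.Combinatorics using (_C_; nCk+nC[k+1]≡[n+1]C[k+1])
open import Data.Nat.ListAction using (sum)
open import Data.Nat.Properties hiding (_≟_; _<?_; <⇒≢)
open import Data.Nat.Solver using (module +-*-Solver)
open import Data.Product using (Σ-syntax; ∃-syntax; _×_; _,_; proj₁; proj₂)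
open import Data.Sum using (_⊎_; inj₁; inj₂; [_,_]′)
import Data.Vec as Vec
open import Function using (_∘_; _↣_; _⇔_; mk⇔; mk↣; const; it)
open import Relation.Binary.Definitions using (Symmetric)
open import Relation.Binary.PropositionalEquality using (_≡_; _≢_; refl; sym; trans; cong; cong₂; subst; subst₂; module ≡-Reasoning)
open import Relation.Nullary using (Dec; yes; no; contradiction; _×-dec_)

open import Defs

private
  variable
    A B : Set

-- Binomial coefficients

nCk≤n^k : ∀ n k → n C k ≤ n ^ k
nCk≤n^k n       zero    = ≤-refl
nCk≤n^k zero    (suc k) = z≤n
nCk≤n^k (suc n) (suc k) = begin
  suc n C suc k             ≡⟨ nCk+nC[k+1]≡[n+1]C[k+1] n k ⟨
  n C k + n C suc k         ≤⟨ +-mono-≤ (nCk≤n^k n k) (nCk≤n^k n (suc k)) ⟩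
  suc n * n ^ k             ≤⟨ *-monoʳ-≤ (suc n) (^-monoˡ-≤ k (n≤1+n n)) ⟩
  suc n ^ suc k             ∎
  where open ≤-Reasoning

-- By Pascal's rule each of the `m` unit increments of the upper index adds a term that is at least
-- `n C k`. The induction carries this monotonicity as its first component.
m*nCk≤[m+n]C[1+k] : ∀ m n k → m * (n C k) ≤ (m + n) C suc k
m*nCk≤[m+n]C[1+k] m n k = proj₂ (both m)
  where
  open ≤-Reasoning
  both : ∀ m → n C k ≤ (m + n) C k × m * (n C k) ≤ (m + n) C suc k
  both zero    = ≤-refl , z≤n
  both (suc m) = mono k (proj₁ (both m)) , (begin
    n C k + m * (n C k)             ≤⟨ +-mono-≤ (proj₁ (both m)) (proj₂ (both m)) ⟩
    (m + n) C k + (m + n) C suc k   ≡⟨ nCk+nC[k+1]≡[n+1]C[k+1] (m + n) k ⟩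
    suc (m + n) C suc k             ∎)
    where
    mono : ∀ k {x} → x ≤ (m + n) C k → x ≤ suc (m + n) C k
    mono zero    x≤ = x≤
    mono (suc k) x≤ = ≤-trans x≤ (≤-trans (m≤n+m _ ((m + n) C k)) (≤-reflexive (nCk+nC[k+1]≡[n+1]C[k+1] (m + n) k)))

-- Combinatorially: split `k * m` points into `k` blocks of size `m` and choose one point from each
-- block.
m^k≤[k*m]Ck : ∀ m k → m ^ k ≤ (k * m) C k
m^k≤[k*m]Ck m zero    = ≤-refl
m^k≤[k*m]Ck m (suc k) = ≤-trans (*-monoʳ-≤ m (m^k≤[k*m]Ck m k)) (m*nCk≤[m+n]C[1+k] m (k * m) k)

-- A tangent line bound, which replaces Jensen's inequality for d ↦ d C (1 + k).
tangent : ∀ d q k → d * q ^ k ≤ d C suc k + k * q ^ suc k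
tangent d q k with k * q ≤? d
... | no kq≰d = begin
  d * q ^ k                         ≤⟨ *-monoˡ-≤ (q ^ k) (<⇒≤ (≰⇒> kq≰d)) ⟩
  k * q * q ^ k                     ≡⟨ *-assoc k q (q ^ k) ⟩
  k * q ^ suc k                     ≤⟨ m≤n+m _ (d C suc k) ⟩
  d C suc k + k * q ^ suc k         ∎
  where open ≤-Reasoning
... | yes kq≤d with m≤n⇒∃[o]m+o≡n kq≤d
-- Here `d` exceeds `k * q` by `x`. Starting from upper index `k * q`, each of the `x` increments
-- raises the binomial by at least `(k * q) C k`, hence by at least `q ^ k`.
... | x , refl = begin
  (k * q + x) * q ^ k               ≡⟨ *-distribʳ-+ (q ^ k) (k * q) x ⟩
  k * q * q ^ k + x * q ^ k         ≡⟨ cong₂ _+_ (*-assoc k q (q ^ k)) refl ⟩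
  k * q ^ suc k + x * q ^ k         ≤⟨ +-monoʳ-≤ (k * q ^ suc k) (*-monoʳ-≤ x (m^k≤[k*m]Ck q k)) ⟩
  k * q ^ suc k + x * ((k * q) C k) ≤⟨ +-monoʳ-≤ (k * q ^ suc k) (m*nCk≤[m+n]C[1+k] x (k * q) k) ⟩
  k * q ^ suc k + (x + k * q) C suc k ≡⟨ cong (λ y → k * q ^ suc k + y C suc k) (+-comm x (k * q)) ⟩
  k * q ^ suc k + (k * q + x) C suc k ≡⟨ +-comm (k * q ^ suc k) _ ⟩
  (k * q + x) C suc k + k * q ^ suc k ∎
  where open ≤-Reasoning

integer-root : ∀ k .{{_ : NonZero k}} N → ∃[ q ] q ^ k ≤ N × N < suc q ^ k
integer-root (suc k) zero = 0 , z≤n , m^n>0 1 (suc k)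
integer-root k (suc N) with integer-root k N
... | q , q^k≤N , N<1+q^k with suc q ^ k ≤? suc N
-- The root grows by at most one, since `suc N` is at most `suc q ^ k`, which lies strictly below
-- the next `k`-th power.
...   | yes p = suc q , p , ≤-<-trans N<1+q^k (^-monoˡ-< k ≤-refl)
...   | no ¬p = q , m≤n⇒m≤1+n q^k≤N , ≰⇒> ¬p

+-<-split : ∀ {a b c d} → a + b < c + d → a < c ⊎ b < d
+-<-split {a} {b} {c} {d} a+b<c+d with suc a ≤? c
... | yes a<c = inj₁ a<c
... | no  a≮c with suc b ≤? d
...   | yes b<d = inj₂ b<d
...   | no  b≮d = contradiction a+b<c+d (≤⇒≯ (+-mono-≤ (≮⇒≥ a≮c) (≮⇒≥ b≮d)))

-- Complete bipartite subgraphs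

module _ {R : A → B → Set} (R? : ∀ x y → Dec (R x y)) where

  degree : List B → A → ℕ
  degree Y x = length (filter (R? x) Y)

  -- Double counting of the pairs of an `x` in `X` and a set of `suc k` of its neighbours in
  -- `y ∷ Y`: the first summand counts the sets that use `y`, the second those that avoid it.
  sum-degree-C-∷ : ∀ X y Y k →
    sum (map (λ x → degree (y ∷ Y) x C suc k) X) ≡
    sum (map (λ x → degree Y x C k) (filter (λ x → R? x y) X)) +
    sum (map (λ x → degree Y x C suc k) X)
  sum-degree-C-∷ []      y Y k = refl
  sum-degree-C-∷ (x ∷ X) y Y k with R? x y
  ... | yes _ = begin
    suc d C suc k + sum (map (λ x → degree (y ∷ Y) x C suc k) X)
      ≡⟨ cong₂ _+_ (sym (nCk+nC[k+1]≡[n+1]C[k+1] d k)) (sum-degree-C-∷ X y Y k) ⟩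
    (d C k + d C suc k) + (u + v)
      ≡⟨ solve 4 (λ a b c d → (a :+ b) :+ (c :+ d) := (a :+ c) :+ (b :+ d)) refl (d C k) (d C suc k) u v ⟩
    (d C k + u) + (d C suc k + v) ∎
    where
    open ≡-Reasoning
    open +-*-Solver
    d u v : ℕ
    d = degree Y x
    u = sum (map (λ x → degree Y x C k) (filter (λ x → R? x y) X))
    v = sum (map (λ x → degree Y x C suc k) X)
  ... | no  _ = begin
    d C suc k + sum (map (λ x → degree (y ∷ Y) x C suc k) X)
      ≡⟨ cong (d C suc k +_) (sum-degree-C-∷ X y Y k) ⟩
    d C suc k + (u + v)
      ≡⟨ solve 3 (λ b c d → b :+ (c :+ d) := c :+ (b :+ d)) refl (d C suc k) u v ⟩
    u + (d C suc k + v) ∎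
    where
    open ≡-Reasoning
    open +-*-Solver
    d u v : ℕ
    d = degree Y x
    u = sum (map (λ x → degree Y x C k) (filter (λ x → R? x y) X))
    v = sum (map (λ x → degree Y x C suc k) X)

  -- Induction on Y: by Pascal's rule the hypothesis splits according to
  -- whether its first element is used.
  kővári–sós–turán : ∀ k r X Y →
    r * (length Y C k) < sum (map (λ x → degree Y x C k) X) →
    ∃[ X′ ] ∃[ Y′ ] X′ ⊆ X × Y′ ⊆ Y × r < length X′ × length Y′ ≡ k ×
      All (λ x → All (R x) Y′) X′
  kővári–sós–turán zero r X Y h =
    X , [] , ⊆-refl , minimum Y , lt , refl , All.universal (λ _ → []) X
    where
    sum-ones : ∀ X → sum (map (λ x → degree Y x C 0) X) ≡ length X
    sum-ones []      = refl
    sum-ones (x ∷ X) = cong suc (sum-ones X)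
    lt : r < length X
    lt = begin-strict
      r                    ≡⟨ *-identityʳ r ⟨
      r * (length Y C 0)   <⟨ h ⟩
      _                    ≡⟨ sum-ones X ⟩
      length X             ∎
      where open ≤-Reasoning
  kővári–sós–turán (suc k) r X [] h =
    contradiction (≤-trans h (≤-reflexive (sum-zeros X))) λ ()
    where
    sum-zeros : ∀ X → sum (map (λ x → degree [] x C suc k) X) ≡ 0
    sum-zeros []      = refl
    sum-zeros (x ∷ X) = sum-zeros X
  kővári–sós–turán (suc k) r X (y ∷ Y) h
    with +-<-split (subst (_< sum-of-next) left (subst (_ <_) (sum-degree-C-∷ X y Y k) h))
    where
    sum-of-next : ℕ
    sum-of-next =
      sum (map (λ x → degree Y x C k) (filter (λ x → R? x y) X)) +
      sum (map (λ x → degree Y x C suc k) X)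
    left : r * (length (y ∷ Y) C suc k) ≡ r * (length Y C k) + r * (length Y C suc k)
    left = trans (cong (r *_) (sym (nCk+nC[k+1]≡[n+1]C[k+1] (length Y) k))) (*-distribˡ-+ r _ _)
  ... | inj₁ h′ =
    let X′ , Y′ , X′⊆ , Y′⊆ , r< , len , all = kővári–sós–turán k r (filter (λ x → R? x y) X) Y h′
    in X′ , y ∷ Y′ , ⊆-trans X′⊆ (filter-⊆ _ X) , refl ∷ Y′⊆ , r< , cong suc len ,
       All.zipWith (λ (p , ps) → p ∷ ps) (All-resp-⊆ X′⊆ (all-filter _ X) , all)
  ... | inj₂ h′ =
    let X′ , Y′ , X′⊆ , Y′⊆ , rest = kővári–sós–turán (suc k) r X Y h′
    in X′ , Y′ , X′⊆ , y ∷ʳ Y′⊆ , rest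

sum-tangent : ∀ (f : A → ℕ) q k X →
  sum (map f X) * q ^ k ≤ sum (map (λ x → f x C suc k) X) + length X * (k * q ^ suc k)
sum-tangent f q k []      = z≤n
sum-tangent f q k (x ∷ X) = begin
  (f x + sum (map f X)) * q ^ k             ≡⟨ *-distribʳ-+ (q ^ k) (f x) _ ⟩
  f x * q ^ k + sum (map f X) * q ^ k       ≤⟨ +-mono-≤ (tangent (f x) q k) (sum-tangent f q k X) ⟩
  (u + v) + (w + length X * v)              ≡⟨ solve 4 (λ u v w z → (u :+ v) :+ (w :+ z) := (u :+ w) :+ (v :+ z)) refl u v w _ ⟩
  (u + w) + (v + length X * v)              ∎
  where
  open ≤-Reasoning
  open +-*-Solver
  u v w : ℕ
  u = f x C suc k
  v = k * q ^ suc k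
  w = sum (map (λ x → f x C suc k) X)

-- Write `n` for the length of `X` and `Q` for `q ^ suc k`. Multiplied by `q ^ k`, the edge bound
-- supplies `r + suc k` copies of `n * Q`. The error of the tangent bound absorbs `k` of them, and
-- the remaining `suc r` beat `r * (n C suc k)` because `n ^ k` is below `Q`.
many-edges : ∀ (f : A → ℕ) r k q X .{{_ : NonZero (length X)}} →
  length X ^ k < q ^ suc k →
  length X * ((r + suc k) * q) ≤ sum (map f X) →
  r * (length X C suc k) < sum (map (λ x → f x C suc k) X)
many-edges f r k q X n^k<q^[1+k] h = begin-strict
  r * (n C suc k)                   ≤⟨ *-monoʳ-≤ r (nCk≤n^k n (suc k)) ⟩
  r * (n * n ^ k)                   ≤⟨ *-monoʳ-≤ r (*-monoʳ-≤ n (<⇒≤ n^k<q^[1+k])) ⟩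
  r * (n * Q)                       <⟨ *-monoˡ-< (n * Q) {{m*n≢0 n Q {{it}} {{>-nonZero (≤-<-trans z≤n n^k<q^[1+k])}}}} (n<1+n r) ⟩
  suc r * (n * Q)                   ≤⟨ +-cancelʳ-≤ (n * (k * Q)) _ _ step ⟩
  sum (map (λ x → f x C suc k) X)   ∎
  where
  open ≤-Reasoning
  open +-*-Solver
  n Q : ℕ
  n = length X
  Q = q ^ suc k
  step : suc r * (n * Q) + n * (k * Q) ≤ sum (map (λ x → f x C suc k) X) + n * (k * Q)
  step = begin
    suc r * (n * Q) + n * (k * Q)
      ≡⟨ solve 5 (λ r k n q p → (con 1 :+ r) :* (n :* (q :* p)) :+ n :* (k :* (q :* p)) :=
                   (n :* ((r :+ (con 1 :+ k)) :* q)) :* p) refl r k n q (q ^ k) ⟩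
    (n * ((r + suc k) * q)) * q ^ k
      ≤⟨ *-monoˡ-≤ (q ^ k) h ⟩
    sum (map f X) * q ^ k
      ≤⟨ sum-tangent f q k X ⟩
    _ ∎

-- Edge counts as degree sums

module _ {P Q : A × B → Set} (P? : ∀ z → Dec (P z)) (Q? : ∀ z → Dec (Q z)) where

  private
    R? : ∀ x y → Dec (Q (x , y) × P (x , y))
    R? x y = Q? (x , y) ×-dec P? (x , y)

  length-filter-row : ∀ x ys →
    length (filter P? (filter Q? (map (x ,_) ys))) ≡ degree R? ys x
  length-filter-row x [] = refl
  length-filter-row x (y ∷ ys) with Q? (x , y)
  ... | no  _ = length-filter-row x ys
  ... | yes _ with P? (x , y)
  ...   | no  _ = length-filter-row x ys
  ...   | yes _ = cong suc (length-filter-row x ys)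

  -- The two nested filters have the shape of the definition of `e`, so that an edge count becomes
  -- the degree sum required for `many-edges`.
  length-filter-cartesianProduct : ∀ xs ys →
    length (filter P? (filter Q? (cartesianProduct xs ys))) ≡ sum (map (degree R? ys) xs)
  length-filter-cartesianProduct []       ys = refl
  length-filter-cartesianProduct (x ∷ xs) ys = begin
    length (filter P? (filter Q? (row ++ rest)))
      ≡⟨ cong (length ∘ filter P?) (filter-++ Q? row rest) ⟩
    length (filter P? (filter Q? row ++ filter Q? rest))
      ≡⟨ cong length (filter-++ P? (filter Q? row) (filter Q? rest)) ⟩
    length (filter P? (filter Q? row) ++ filter P? (filter Q? rest))
      ≡⟨ length-++ (filter P? (filter Q? row)) ⟩
    length (filter P? (filter Q? row)) + length (filter P? (filter Q? rest))
      ≡⟨ cong₂ _+_ (length-filter-row x ys) (length-filter-cartesianProduct xs ys) ⟩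
    degree R? ys x + sum (map (degree R? ys) xs) ∎
    where
    open ≡-Reasoning
    row rest : List (A × B)
    row  = map (x ,_) ys
    rest = cartesianProduct xs ys

-- Ramsey's theorem

AllPairs-resp-⊆ : {R : A → A → Set} {xs ys : List A} → xs ⊆ ys → AllPairs R ys → AllPairs R xs
AllPairs-resp-⊆ []           []       = []
AllPairs-resp-⊆ (_ ∷ʳ τ)     (_ ∷ ps) = AllPairs-resp-⊆ τ ps
AllPairs-resp-⊆ (refl ∷ τ)   (p ∷ ps) = All-resp-⊆ τ p ∷ AllPairs-resp-⊆ τ ps

-- Only `M + N ∸ 1` elements are required. This slack of one pays for the vertex set aside in
-- `ramsey` and for the entry that `remove` may drop in `bipartite-ramsey`.
pigeonhole : {P Q : A → Set} → ∀ M N xs → M + N ≤ suc (length xs) → All (λ x → P x ⊎ Q x) xs →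
  (∃[ ys ] ys ⊆ xs × M ≤ length ys × All P ys) ⊎
  (∃[ ys ] ys ⊆ xs × N ≤ length ys × All Q ys)
pigeonhole zero    N       xs h _ = inj₁ ([] , minimum xs , z≤n , [])
pigeonhole (suc M) zero    xs h _ = inj₂ ([] , minimum xs , z≤n , [])
pigeonhole (suc M) (suc N) [] h _ with s≤s h′ ← h = contradiction (≤-trans (m≤n+m (suc N) M) h′) λ ()
pigeonhole (suc M) (suc N) (x ∷ xs) (s≤s h) (inj₁ p ∷ ps) with pigeonhole M (suc N) xs h ps
... | inj₁ (ys , ys⊆ , len , all) = inj₁ (x ∷ ys , refl ∷ ys⊆ , s≤s len , p ∷ all)
... | inj₂ (ys , ys⊆ , len , all) = inj₂ (ys , x ∷ʳ ys⊆ , len , all)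
pigeonhole (suc M) (suc N) (x ∷ xs) (s≤s h) (inj₂ q ∷ ps)
  with pigeonhole (suc M) N xs (≤-trans (≤-reflexive (sym (+-suc M N))) h) ps
... | inj₁ (ys , ys⊆ , len , all) = inj₁ (ys , x ∷ʳ ys⊆ , len , all)
... | inj₂ (ys , ys⊆ , len , all) = inj₂ (x ∷ ys , refl ∷ ys⊆ , s≤s len , q ∷ all)

2^[1+n]*m : ∀ n m → 2 ^ suc n * m ≡ 2 ^ n * m + 2 ^ n * m
2^[1+n]*m n m = trans (cong (_* m) (cong (2 ^ n +_) (+-identityʳ (2 ^ n)))) (*-distribʳ-+ m (2 ^ n) (2 ^ n))

-- The head keeps the later elements related to it by whichever of `P` and `Q` is frequent enough.
-- This at worst halves the bound and lowers `a` or `b` by one, which the bound `2 ^ (a + b)` allows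
-- for.
ramsey : {P Q : A → A → Set} → ∀ a b xs → 2 ^ (a + b) ≤ length xs →
  AllPairs (λ x y → P x y ⊎ Q x y) xs →
  (∃[ ys ] ys ⊆ xs × length ys ≡ a × AllPairs P ys) ⊎
  (∃[ ys ] ys ⊆ xs × length ys ≡ b × AllPairs Q ys)
ramsey zero    b       xs h ps = inj₁ ([] , minimum xs , refl , [])
ramsey (suc a) zero    xs h ps = inj₂ ([] , minimum xs , refl , [])
ramsey (suc a) (suc b) [] h ps = contradiction (≤-trans (m^n>0 2 (suc a + suc b)) h) λ ()
ramsey (suc a) (suc b) (x ∷ xs) h (p ∷ ps)
  with pigeonhole (2 ^ (a + suc b)) (2 ^ (a + suc b)) xs
         (≤-trans (≤-reflexive (cong (2 ^ (a + suc b) +_) (sym (+-identityʳ _)))) h) p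
... | inj₁ (ys , ys⊆ , len , all) with ramsey a (suc b) ys len (AllPairs-resp-⊆ ys⊆ ps)
...   | inj₁ (zs , zs⊆ , len′ , all′) =
        inj₁ (x ∷ zs , refl ∷ ⊆-trans zs⊆ ys⊆ , cong suc len′ , All-resp-⊆ zs⊆ all ∷ all′)
...   | inj₂ (zs , zs⊆ , rest) = inj₂ (zs , x ∷ʳ ⊆-trans zs⊆ ys⊆ , rest)
ramsey (suc a) (suc b) (x ∷ xs) h (p ∷ ps)
    | inj₂ (ys , ys⊆ , len , all)
    with ramsey (suc a) b ys (≤-trans (≤-reflexive (cong (2 ^_) (sym (+-suc a b)))) len) (AllPairs-resp-⊆ ys⊆ ps)
...   | inj₁ (zs , zs⊆ , rest) = inj₁ (zs , x ∷ʳ ⊆-trans zs⊆ ys⊆ , rest)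
...   | inj₂ (zs , zs⊆ , len′ , all′) =
        inj₂ (x ∷ zs , refl ∷ ⊆-trans zs⊆ ys⊆ , cong suc len′ , All-resp-⊆ zs⊆ all ∷ all′)

-- Uniqueness limits the loss to one entry. What remains is distinct from `x`, so that every pair
-- with `x` is an edge and has a meaningful colour.
remove : ∀ {n} (x : Fin n) ys → Unique ys →
  ∃[ zs ] zs ⊆ ys × length ys ≤ suc (length zs) × All (x ≢_) zs
remove x [] [] = [] , [] , z≤n , []
remove x (y ∷ ys) (y∉ys ∷ ys!) with x ≟ y
... | yes refl = ys , y ∷ʳ ⊆-refl , ≤-refl , y∉ys
... | no  x≢y  =
  let zs , zs⊆ , len , all = remove x ys ys!
  in y ∷ zs , refl ∷ zs⊆ , s≤s len , x≢y ∷ all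

lookup-AllPairs : {R : A → A → Set} → Symmetric R → ∀ {xs} → AllPairs R xs →
  ∀ i j → i ≢ j → R (lookup xs i) (lookup xs j)
lookup-AllPairs R-sym (p ∷ ps) zero    zero    i≢j = contradiction refl i≢j
lookup-AllPairs R-sym (p ∷ ps) zero    (suc j) i≢j = All.lookup p (∈-lookup j)
lookup-AllPairs R-sym (p ∷ ps) (suc i) zero    i≢j = R-sym (All.lookup p (∈-lookup i))
lookup-AllPairs R-sym (p ∷ ps) (suc i) (suc j) i≢j = lookup-AllPairs R-sym ps i j (i≢j ∘ cong suc)

-- Two-part colour patterns

segment : ∀ p q → Subset (p + q)
segment p q = ⊤ {p} Vec.++ ⊥ {q}

∣segment∣ : ∀ p q → ∣ segment p q ∣ ≡ p
∣segment∣ zero    q = ∣⊥∣≡0 q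
∣segment∣ (suc p) q = cong suc (∣segment∣ p q)

-- Stated through `splitAt` so that one case split decides both membership in the segment and the
-- value of `patternColour`.
∈-segment : ∀ p q i → [ const (i ∈ segment p q) , const (i ∉ segment p q) ]′ (splitAt p i)
∈-segment zero    q i       = ∉⊥
∈-segment (suc p) q zero    = Vec.here
∈-segment (suc p) q (suc i) with splitAt p i | ∈-segment p q i
... | inj₁ _ | i∈ = Vec.there i∈
... | inj₂ _ | i∉ = i∉ ∘ drop-there

patternColour : Colour → Colour → Colour → A ⊎ B → A ⊎ B → Colour
patternColour a b c (inj₁ _) (inj₁ _) = a
patternColour a b c (inj₂ _) (inj₂ _) = b
patternColour a b c _        _        = c

-- Cliques and joined pairs in a colouring

module _ {n} (χ : Colouring n) where

  -- Distinctness is included because the diagonal of a colouring has no meaning. It also forces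
  -- cliques to be repetition-free and joined lists to be disjoint.
  Edge : Colour → Fin n → Fin n → Set
  Edge c x y = x ≢ y × colour χ x y ≡ c

  Edge-sym : ∀ {c} → Symmetric (Edge c)
  Edge-sym (x≢y , eq) = x≢y ∘ sym , trans (symmetric χ _ _) eq

  red-or-blue : ∀ {x y} → x ≢ y → Edge red x y ⊎ Edge blue x y
  red-or-blue {x} {y} x≢y with colour χ x y
  ... | red  = inj₁ (x≢y , refl)
  ... | blue = inj₂ (x≢y , refl)

  Clique : Colour → List (Fin n) → Set
  Clique c = AllPairs (Edge c)

  Joined : Colour → List (Fin n) → List (Fin n) → Set
  Joined c X Y = All (λ x → All (Edge c x) Y) X

  -- Distinct indices are sent to the two ends of an `Edge`, whose distinctness yields injectivity
  -- of the embedding.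
  embed-pattern : ∀ {a b c X Y} → Clique a X → Clique b Y → Joined c X Y →
    Σ[ f ∈ Fin (length X + length Y) ↣ Fin n ] ∀ i j → i ≢ j →
      colour (restrict f χ) i j ≡ patternColour a b c (splitAt (length X) i) (splitAt (length X) j)
  embed-pattern {a} {b} {c} {X} {Y} X-clique Y-clique joined =
    mk↣ {to = f} f-injective , λ i j i≢j → proj₂ (f-edge i j i≢j)
    where
    g : Fin (length X) ⊎ Fin (length Y) → Fin n
    g = [ lookup X , lookup Y ]′

    joined-at : ∀ i j → Edge c (lookup X i) (lookup Y j)
    joined-at i j = All.lookup (All.lookup joined (∈-lookup i)) (∈-lookup j)

    g-edge : ∀ u v → u ≢ v → Edge (patternColour a b c u v) (g u) (g v)
    g-edge (inj₁ i) (inj₁ j) u≢v = lookup-AllPairs Edge-sym X-clique i j (u≢v ∘ cong inj₁)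
    g-edge (inj₁ i) (inj₂ j) u≢v = joined-at i j
    g-edge (inj₂ i) (inj₁ j) u≢v = Edge-sym (joined-at j i)
    g-edge (inj₂ i) (inj₂ j) u≢v = lookup-AllPairs Edge-sym Y-clique i j (u≢v ∘ cong inj₂)

    f : Fin (length X + length Y) → Fin n
    f = g ∘ splitAt (length X)

    splitAt-injective : ∀ {i j} → splitAt (length X) i ≡ splitAt (length X) j → i ≡ j
    splitAt-injective {i} {j} eq = trans (sym (join-splitAt (length X) (length Y) i))
      (trans (cong (join (length X) (length Y)) eq) (join-splitAt (length X) (length Y) j))

    f-edge : ∀ i j → i ≢ j →
      Edge (patternColour a b c (splitAt (length X) i) (splitAt (length X) j)) (f i) (f j)
    f-edge i j i≢j = g-edge _ _ (i≢j ∘ splitAt-injective)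

    f-injective : ∀ {i j} → f i ≡ f j → i ≡ j
    f-injective {i} {j} eq with i ≟ j
    ... | yes i≡j = i≡j
    ... | no  i≢j = contradiction eq (proj₁ (f-edge i j i≢j))

  -- The cross edges share the colour of the clique on `Y`, so colour `a` occurs exactly inside `X`.
  contains-TypeA : ∀ {a b t X Y} → a ≢ b → length X ≡ t → length Y ≡ t →
    Clique a X → Clique b Y → Joined b X Y → ContainsCopy (TypeA t) χ
  contains-TypeA {a} {b} {t} {X} {Y} a≢b refl |Y|≡t X-clique Y-clique joined
    -- `2 * t` unfolds to `t + (t + 0)`, so the length of `Y` has to be matched with `t + 0`.
    with length Y | trans |Y|≡t (sym (+-identityʳ t)) | embed-pattern X-clique Y-clique joined
  ... | _ | refl | f , f-colour =
    f , a , segment t (t + 0) , ∣segment∣ t (t + 0) , characterise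
    where
    S : Subset (t + (t + 0))
    S = segment t (t + 0)
    characterise : ∀ i j → i ≢ j → (colour (restrict f χ) i j ≡ a ⇔ (i ∈ S × j ∈ S))
    characterise i j i≢j
      with splitAt t i | ∈-segment t (t + 0) i | splitAt t j | ∈-segment t (t + 0) j | f-colour i j i≢j
    ... | inj₁ _ | i∈ | inj₁ _ | j∈ | eq = mk⇔ (λ _ → i∈ , j∈) (λ _ → eq)
    ... | inj₁ _ | i∈ | inj₂ _ | j∉ | eq = mk⇔ (λ eq′ → contradiction (trans (sym eq′) eq) a≢b)
      (λ (_ , j∈) → contradiction j∈ j∉)
    ... | inj₂ _ | i∉ | inj₁ _ | j∈ | eq = mk⇔ (λ eq′ → contradiction (trans (sym eq′) eq) a≢b)
      (λ (i∈ , _) → contradiction i∈ i∉)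
    ... | inj₂ _ | i∉ | inj₂ _ | j∉ | eq = mk⇔ (λ eq′ → contradiction (trans (sym eq′) eq) a≢b)
      (λ (i∈ , _) → contradiction i∈ i∉)

  contains-TypeB : ∀ {a c t X Y} → c ≢ a → length X ≡ t → length Y ≡ t →
    Clique a X → Clique a Y → Joined c X Y → ContainsCopy (TypeB t) χ
  contains-TypeB {a} {c} {t} {X} {Y} c≢a refl |Y|≡t X-clique Y-clique joined
    with length Y | trans |Y|≡t (sym (+-identityʳ t)) | embed-pattern X-clique Y-clique joined
  ... | _ | refl | f , f-colour =
    f , c , segment t (t + 0) , ∣segment∣ t (t + 0) , characterise
    where
    S : Subset (t + (t + 0))
    S = segment t (t + 0)
    characterise : ∀ i j → i ≢ j →
      (colour (restrict f χ) i j ≡ c ⇔ ((i ∈ S × j ∉ S) ⊎ (i ∉ S × j ∈ S)))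
    characterise i j i≢j
      with splitAt t i | ∈-segment t (t + 0) i | splitAt t j | ∈-segment t (t + 0) j | f-colour i j i≢j
    ... | inj₁ _ | i∈ | inj₁ _ | j∈ | eq = mk⇔ (λ eq′ → contradiction (trans (sym eq′) eq) c≢a)
      [ (λ (_ , j∉) → contradiction j∈ j∉) , (λ (i∉ , _) → contradiction i∈ i∉) ]′
    ... | inj₁ _ | i∈ | inj₂ _ | j∉ | eq = mk⇔ (λ _ → inj₁ (i∈ , j∉)) (λ _ → eq)
    ... | inj₂ _ | i∉ | inj₁ _ | j∈ | eq = mk⇔ (λ _ → inj₂ (i∉ , j∈)) (λ _ → eq)
    ... | inj₂ _ | i∉ | inj₂ _ | j∉ | eq = mk⇔ (λ eq′ → contradiction (trans (sym eq′) eq) c≢a)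
      [ (λ (i∈ , _) → contradiction i∈ i∉) , (λ (_ , j∈) → contradiction j∈ j∉) ]′

  -- The vertices of `X` are taken one at a time. Each keeps a part of `Y` to which it is joined in
  -- one colour, at the cost of a factor of two, and lowers the target for that colour by one. A
  -- target of zero is met by the empty list, vacuously joined to `Y`. The lists may overlap, hence
  -- the use of `remove`.
  bipartite-ramsey : ∀ a b t X Y → a + b ≤ length X → 2 ^ (a + b) * t ≤ length Y → Unique Y →
    ∃[ X′ ] ∃[ Y′ ] X′ ⊆ X × Y′ ⊆ Y × t ≤ length Y′ ×
      ((length X′ ≡ a × Joined red X′ Y′) ⊎ (length X′ ≡ b × Joined blue X′ Y′))
  bipartite-ramsey zero b t X Y |X| |Y| Y! =
    [] , Y , minimum X , ⊆-refl , ≤-trans (m≤n*m t (2 ^ b) {{m^n≢0 2 b}}) |Y| , inj₁ (refl , [])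
  bipartite-ramsey a@(suc _) zero t X Y |X| |Y| Y! =
    [] , Y , minimum X , ⊆-refl , ≤-trans (m≤n*m t (2 ^ (a + 0)) {{m^n≢0 2 (a + 0)}}) |Y| , inj₂ (refl , [])
  bipartite-ramsey (suc a) (suc b) t (x ∷ X) Y (s≤s |X|) |Y| Y!
    with remove x Y Y!
  ... | Y₀ , Y₀⊆ , |Y₀| , x∉Y₀
    with pigeonhole (2 ^ (a + suc b) * t) (2 ^ (a + suc b) * t) Y₀
           (≤-trans (≤-reflexive (sym (2^[1+n]*m (a + suc b) t))) (≤-trans |Y| |Y₀|))
           (All.map red-or-blue x∉Y₀)
  ... | inj₁ (Y₁ , Y₁⊆ , |Y₁| , x-Y₁)
      with bipartite-ramsey a (suc b) t X Y₁ |X| |Y₁| (AllPairs-resp-⊆ (⊆-trans Y₁⊆ Y₀⊆) Y!)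
  ...   | X′ , Y′ , X′⊆ , Y′⊆ , |Y′| , inj₁ (|X′| , joined) =
          x ∷ X′ , Y′ , refl ∷ X′⊆ , ⊆-trans Y′⊆ (⊆-trans Y₁⊆ Y₀⊆) , |Y′| ,
          inj₁ (cong suc |X′| , All-resp-⊆ Y′⊆ x-Y₁ ∷ joined)
  ...   | X′ , Y′ , X′⊆ , Y′⊆ , |Y′| , inj₂ joined =
          X′ , Y′ , x ∷ʳ X′⊆ , ⊆-trans Y′⊆ (⊆-trans Y₁⊆ Y₀⊆) , |Y′| , inj₂ joined
  bipartite-ramsey (suc a) (suc b) t (x ∷ X) Y (s≤s |X|) |Y| Y!
    | Y₀ , Y₀⊆ , |Y₀| , x∉Y₀
    | inj₂ (Y₁ , Y₁⊆ , |Y₁| , x-Y₁)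
      with bipartite-ramsey (suc a) b t X Y₁ (≤-trans (≤-reflexive (sym (+-suc a b))) |X|)
             (≤-trans (≤-reflexive (cong (λ m → 2 ^ m * t) (sym (+-suc a b)))) |Y₁|)
             (AllPairs-resp-⊆ (⊆-trans Y₁⊆ Y₀⊆) Y!)
  ...   | X′ , Y′ , X′⊆ , Y′⊆ , |Y′| , inj₁ joined =
          X′ , Y′ , x ∷ʳ X′⊆ , ⊆-trans Y′⊆ (⊆-trans Y₁⊆ Y₀⊆) , |Y′| , inj₁ joined
  ...   | X′ , Y′ , X′⊆ , Y′⊆ , |Y′| , inj₂ (|X′| , joined) =
          x ∷ X′ , Y′ , refl ∷ X′⊆ , ⊆-trans Y′⊆ (⊆-trans Y₁⊆ Y₀⊆) , |Y′| ,
          inj₂ (cong suc |X′| , All-resp-⊆ Y′⊆ x-Y₁ ∷ joined)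

  monochromatic-clique : ∀ k X → Unique X → 2 ^ (k + k) ≤ length X →
    ∃[ c ] ∃[ Y ] Y ⊆ X × length Y ≡ k × Clique c Y
  monochromatic-clique k X X! h with ramsey k k X h (AllPairs.map red-or-blue X!)
  ... | inj₁ (Y , rest) = red  , Y , rest
  ... | inj₂ (Y , rest) = blue , Y , rest

  take-clique : ∀ {c t} X → t ≤ length X → Clique c X → length (take t X) ≡ t × Clique c (take t X)
  take-clique {t = t} X t≤ X-clique = trans (length-take t X) (m≤n⇒m⊓n≡m t≤) , AllPairsₚ.take⁺ t X-clique

  TypeA-from-cliques : ∀ t X Y → t + t ≤ length X → 2 ^ (t + t) * t ≤ length Y →
    Clique red X → Clique blue Y → ContainsCopy (TypeA t) χ
  TypeA-from-cliques t X Y |X| |Y| X-red Y-blue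
    with bipartite-ramsey t t t X Y |X| |Y| (AllPairs.map proj₁ Y-blue)
  ... | X′ , Y′ , X′⊆ , Y′⊆ , |Y′| , inj₁ (|X′| , joined) =
        -- The cross edges are red like those inside `X′`, so the blue clique is the distinguished
        -- one and the join is transposed.
        let |Z| , Z-blue = take-clique Y′ |Y′| (AllPairs-resp-⊆ Y′⊆ Y-blue) in
        contains-TypeA (λ ()) |Z| |X′| Z-blue (AllPairs-resp-⊆ X′⊆ X-red)
          (All.map (All.map Edge-sym) (All-swap (All.map (Allₚ.take⁺ t) joined)))
  ... | X′ , Y′ , X′⊆ , Y′⊆ , |Y′| , inj₂ (|X′| , joined) =
        let |Z| , Z-blue = take-clique Y′ |Y′| (AllPairs-resp-⊆ Y′⊆ Y-blue) in
        contains-TypeA (λ ()) |X′| |Z| (AllPairs-resp-⊆ X′⊆ X-red) Z-blue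
          (All.map (Allₚ.take⁺ t) joined)

  -- The clique has length `k` rather than `t` because a bipartite Ramsey argument is still to be
  -- applied to it.
  TypeB-or-clique : ∀ c t k X Y → t ≤ k → Unique X → Unique Y →
    2 ^ (k + k) ≤ length X → 2 ^ (k + k) ≤ length Y → Joined c X Y →
    ContainsCopy (TypeB t) χ ⊎ ∃[ Z ] length Z ≡ k × Clique c Z
  TypeB-or-clique c t k X Y t≤k X! Y! |X| |Y| joined
    with monochromatic-clique k X X! |X| | monochromatic-clique k Y Y! |Y|
  ... | a , X′ , X′⊆ , |X′| , X′-clique | b , Y′ , Y′⊆ , |Y′| , Y′-clique
    with a ≟ᶜ c | b ≟ᶜ c
  ... | yes refl | _        = inj₂ (X′ , |X′| , X′-clique)
  ... | no _     | yes refl = inj₂ (Y′ , |Y′| , Y′-clique)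
  ... | no a≢c   | no b≢c with unique-other a≢c b≢c
    where
    unique-other : ∀ {a b c} → a ≢ c → b ≢ c → a ≡ b
    unique-other {red}  {red}  a≢c b≢c = refl
    unique-other {blue} {blue} a≢c b≢c = refl
    unique-other {red}  {blue} {red}  a≢c b≢c = contradiction refl a≢c
    unique-other {red}  {blue} {blue} a≢c b≢c = contradiction refl b≢c
    unique-other {blue} {red}  {red}  a≢c b≢c = contradiction refl b≢c
    unique-other {blue} {red}  {blue} a≢c b≢c = contradiction refl a≢c
  ... | refl =
    let |U| , U-clique = take-clique X′ (≤-trans t≤k (≤-reflexive (sym |X′|))) X′-clique
        |V| , V-clique = take-clique Y′ (≤-trans t≤k (≤-reflexive (sym |Y′|))) Y′-clique
    in inj₁ (contains-TypeB (a≢c ∘ sym) |U| |V| U-clique V-clique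
         (Allₚ.take⁺ t (All.map (Allₚ.take⁺ t ∘ All-resp-⊆ Y′⊆) (All-resp-⊆ X′⊆ joined))))

  large-joined-pair : ∀ c k q .{{_ : NonZero n}} → n ^ k < q ^ suc k →
    n * ((suc k + suc k) * q) ≤ e c χ →
    ∃[ X ] ∃[ Y ] Unique X × Unique Y × suc k ≤ length X × suc k ≤ length Y × Joined c X Y
  large-joined-pair c k q n^k<q^[1+k] h
    with kővári–sós–turán R? (suc k) (suc k) (allFin n) (allFin n) enough
    where
    R? : ∀ x y → Dec _
    -- With `x` before `y` each edge is counted once, so the degree sum is exactly `e c χ`; the
    -- order also gives distinctness.
    R? x y = (x <? y) ×-dec (colour χ x y ≟ᶜ c)
    enough : suc k * (length (allFin n) C suc k) < sum (map (λ x → degree R? (allFin n) x C suc k) (allFin n))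
    enough = many-edges (degree R? (allFin n)) (suc k) k q (allFin n)
      {{subst NonZero (sym (length-tabulate {n = n} _)) it}}
      (subst (λ m → m ^ k < q ^ suc k) (sym (length-tabulate {n = n} _)) n^k<q^[1+k])
      (subst₂ (λ m E → m * ((suc k + suc k) * q) ≤ E) (sym (length-tabulate {n = n} _))
        (length-filter-cartesianProduct _ _ (allFin n) (allFin n)) h)
  ... | X , Y , X⊆ , Y⊆ , |X| , |Y| , joined =
    X , Y , AllPairs-resp-⊆ X⊆ (allFin⁺ n) , AllPairs-resp-⊆ Y⊆ (allFin⁺ n) , <⇒≤ |X| , ≤-reflexive (sym |Y|) ,
    All.map (All.map λ (x<y , eq) → <⇒≢ x<y , eq) joined

-- The threshold and the choice of parameters

^-distribʳ-* : ∀ m n k → (m * n) ^ k ≡ m ^ k * n ^ k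
^-distribʳ-* m n zero    = refl
^-distribʳ-* m n (suc k) = trans (cong (m * n *_) (^-distribʳ-* m n k))
  (solve 4 (λ m n a b → (m :* n) :* (a :* b) := (m :* a) :* (n :* b)) refl m n (m ^ k) (n ^ k))
  where open +-*-Solver

-- root j n = ⌊ n ^ (j / (1 + j)) ⌋, so that threshold j n is of order
-- n ^ (2 - 1 / (1 + j)).
root : ℕ → ℕ → ℕ
root j n = proj₁ (integer-root (suc j) (n ^ j))

threshold : ℕ → ℕ → ℕ
threshold j n = n * ((suc j + suc j) * (2 * root j n))

threshold-isO : ∀ j → IsO[n^2-1/ suc j ] (threshold j)
threshold-isO j = c , 0 , λ n _ → begin
  threshold j n ^ s
    ≡⟨ cong (_^ s) (solve 3 (λ n c q → n :* (c :* (con 2 :* q)) := (c :* con 2) :* (n :* q)) refl n (s + s) (root j n)) ⟩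
  (c * (n * root j n)) ^ s                ≡⟨ ^-distribʳ-* c (n * root j n) s ⟩
  c ^ s * (n * root j n) ^ s              ≡⟨ cong (c ^ s *_) (^-distribʳ-* n (root j n) s) ⟩
  c ^ s * (n ^ s * root j n ^ s)          ≤⟨ *-monoʳ-≤ (c ^ s) (*-monoʳ-≤ (n ^ s) (proj₁ (proj₂ (integer-root s (n ^ j))))) ⟩
  c ^ s * (n ^ s * n ^ j)                 ≡⟨ cong (c ^ s *_) (^-distribˡ-+-* n s j) ⟨
  -- As `s` is `suc j`, the exponent `2 * s ∸ 1` computes to `j + (s + 0)`.
  c ^ s * n ^ (s + j)                     ≡⟨ cong (λ x → c ^ s * n ^ x) (trans (+-comm s j) (cong (j +_) (sym (+-identityʳ s)))) ⟩
  c ^ s * n ^ (2 * s ∸ 1)                 ∎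
  where
  open ≤-Reasoning
  open +-*-Solver
  s c : ℕ
  s = suc j
  c = (s + s) * 2

-- The upper bound on the threshold uses the rounded-down root, but Kővári-Sós-Turán requires its
-- successor. The factor 2 in `threshold` covers the difference, as the root is at least 1 when `n`
-- is nonzero.
threshold-large : ∀ j n .{{_ : NonZero n}} → n * ((suc j + suc j) * suc (root j n)) ≤ threshold j n
threshold-large j n with integer-root (suc j) (n ^ j)
... | zero  , _ , h = contradiction (subst (n ^ j <_) (^-zeroˡ (suc j)) h) (≤⇒≯ (m^n>0 n j))
... | suc q , _ , _ = *-monoʳ-≤ n (*-monoʳ-≤ (suc j + suc j)
                        (≤-trans (s≤s (m≤n+m (suc q) q)) (≤-reflexive (cong (λ x → suc (q + suc x)) (sym (+-identityʳ q))))))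

clique-or-TypeB : ∀ {n} .{{_ : NonZero n}} (χ : Colouring n) {t j k} → t ≤ k → suc j ≡ 2 ^ (k + k) →
  ∀ c → threshold j n ≤ e c χ → ContainsCopy (TypeB t) χ ⊎ ∃[ Z ] length Z ≡ k × Clique χ c Z
clique-or-TypeB {n} χ {t} {j} {k} t≤k 1+j≡2^[k+k] c h =
  let X , Y , X! , Y! , |X| , |Y| , joined =
        large-joined-pair χ c j (suc (root j n)) (proj₂ (proj₂ (integer-root (suc j) (n ^ j))))
          (≤-trans (threshold-large j n) h)
  in TypeB-or-clique χ c t k X Y t≤k X! Y!
       (subst (_≤ length X) 1+j≡2^[k+k] |X|) (subst (_≤ length Y) 1+j≡2^[k+k] |Y|) joined

-- The two summands of `k` are the lengths that `bipartite-ramsey` demands of its two sides, so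
-- cliques of length `k` meet both demands.
TypeA-or-TypeB : ∀ {n} .{{_ : NonZero n}} (χ : Colouring n) {t j k} →
  k ≡ (t + t) + 2 ^ (t + t) * t → suc j ≡ 2 ^ (k + k) →
  threshold j n ≤ e red χ ⊓ e blue χ → ContainsCopy (TypeA t) χ ⊎ ContainsCopy (TypeB t) χ
TypeA-or-TypeB χ {t} {j} {k} k≡ 1+j≡ h =
  combine (clique-or-TypeB χ t≤k 1+j≡ red (≤-trans h (m⊓n≤m _ _)))
          (clique-or-TypeB χ t≤k 1+j≡ blue (≤-trans h (m⊓n≤n _ _)))
  where
  2t≤k : t + t ≤ k
  2t≤k = ≤-trans (m≤m+n (t + t) _) (≤-reflexive (sym k≡))
  t≤k : t ≤ k
  t≤k = ≤-trans (m≤m+n t t) 2t≤k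
  combine : ContainsCopy (TypeB t) χ ⊎ (∃[ Z ] length Z ≡ k × Clique χ red Z) →
            ContainsCopy (TypeB t) χ ⊎ (∃[ Z ] length Z ≡ k × Clique χ blue Z) →
            ContainsCopy (TypeA t) χ ⊎ ContainsCopy (TypeB t) χ
  combine (inj₁ typeB) _            = inj₂ typeB
  combine (inj₂ _)     (inj₁ typeB) = inj₂ typeB
  combine (inj₂ (X , |X| , X-red)) (inj₂ (Y , |Y| , Y-blue)) =
    inj₁ (TypeA-from-cliques χ t X Y
      (≤-trans 2t≤k (≤-reflexive (sym |X|)))
      (≤-trans (m≤n+m _ (t + t)) (≤-reflexive (sym (trans |Y| k≡))))
      X-red Y-blue)

theorem2p1 : (t : ℕ) → NonZero t →
    Σ[ m ∈ ℕ ] NonZero m ×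
    (Σ[ φ ∈ (ℕ → ℕ) ] IsO[n^2-1/ m ] φ ×
    (∃[ N ] (∀ n → N ≤ n → (χ : Colouring n) →
    φ n ≤ e red χ ⊓ e blue χ →
    ContainsCopy (TypeA t) χ ⊎ ContainsCopy (TypeB t) χ)))
theorem2p1 t _ =
  -- The exponent parameter `m` is `2 ^ (k + k)`, the side length at which Ramsey's theorem gives a
  -- clique of length `k`. Starting at `n = 1` makes `n` nonzero.
  suc j , _ , threshold j , threshold-isO j , 1 , λ n 1≤n χ →
    TypeA-or-TypeB {{>-nonZero 1≤n}} χ {t} {j} {k} refl 1+j≡2^[k+k]
  where
  k j : ℕ
  k = (t + t) + 2 ^ (t + t) * t
  j = pred (2 ^ (k + k))

  1+j≡2^[k+k] : suc j ≡ 2 ^ (k + k)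
  1+j≡2^[k+k] = suc-pred (2 ^ (k + k)) {{m^n≢0 2 (k + k)}}
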